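{- Let $\mathbf{C}$ be a locally small directed category with finite Ramsey degrees. Then $\mathbf{C}$ has the weak amalgamation property.
   Context: $\mathrm{Ob}(\mathbf{C})$ is the class of objects of $\mathbf{C}$, composition is written with a dot, and $A \to B$ means $\hom(A,B) \neq \varnothing$. A category is directed if for all objects $A, B$ there is an object $C$ with $A \to C$ and $B \to C$. For positive integers $k,t$ and objects $A,B,C$ with $A \to B$, write $C \longrightarrow (B)^A_{k,t}$ if for every coloring $\chi : \hom(A,C) \to \{0,\dots,k-1\}$ there is a $w \in \hom(B,C)$ such that $|\{\chi(w\cdot f) : f \in \hom(A,B)\}| \le t$. The Ramsey degree $t_{\mathbf{C}}(A)$ of $A$ in $\mathbf{C}$ is the least positive integer $n$ such that for all $k$ and all objects $B$ with $A\to B$ there is an object $C$ with $C \longrightarrow (B)^A_{k,n}$, if such $n$ exists, and $\infty$ otherwise. $\mathbf{C}$ has finite Ramsey degrees if $t_{\mathbf{C}}(A) < \infty$ for all $A \in \mathrm{Ob}(\mathbf{C})$. $\mathbf{C}$ has the weak amalgamation property if for every $A \in \mathrm{Ob}(\mathbf{C})$ there are $A' \in \mathrm{Ob}(\mathbf{C})$ and a morphism $f \in \hom(A,A')$ such that for all $B, C \in \mathrm{Ob}(\mathbf{C})$ and all $g \in \hom(A',B)$, $h \in \hom(A',C)$ there are $D \in \mathrm{Ob}(\mathbf{C})$ and morphisms $r \in \hom(B,D)$, $s \in \hom(C,D)$ with $r\cdot g\cdot f = s\cdot h\cdot f$. -}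

module Defs where

open import Level using (Level; _⊔_; suc)
open import Data.Nat using (ℕ; _≤_; NonZero)
open import Data.Fin using (Fin)
open import Data.Fin.Subset using (Subset; _∈_; ∣_∣)
open import Data.Product using (∃; ∃-syntax; _×_)
open import Function.Bundles using (Func; _⟶ₛ_; _⇔_)
open import Relation.Binary.Bundles using (Setoid)
open import Relation.Binary.PropositionalEquality using (_≡_; setoid)
open import Relation.Nullary using (¬_)
open import Relation.Nullary.Construct.Add.Supremum using (_⁺; ⊤⁺; [_])

private
  variable
    o ℓ e : Level

-- Local smallness is the typing of hom: each hom(A,B) is a setoid in fixed
-- universes ℓ, e, whereas Obj may live in an arbitrarily large universe o.
-- Equality of morphisms is the setoid equality.
record Category (o ℓ e : Level) : Set (suc (o ⊔ ℓ ⊔ e)) where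
  infix  4 _≈_
  infixr 9 _·_
  field
    Obj : Set o
    hom : Obj → Obj → Setoid ℓ e

  Hom : Obj → Obj → Set ℓ
  Hom A B = Setoid.Carrier (hom A B)

  _≈_ : ∀ {A B} → Hom A B → Hom A B → Set e
  _≈_ {A} {B} = Setoid._≈_ (hom A B)

  field
    id     : ∀ {A} → Hom A A
    _·_    : ∀ {A B C} → Hom B C → Hom A B → Hom A C
    assoc  : ∀ {A B C D} (h : Hom C D) (g : Hom B C) (f : Hom A B) →
             (h · g) · f ≈ h · (g · f)
    idˡ    : ∀ {A B} (f : Hom A B) → id · f ≈ f
    idʳ    : ∀ {A B} (f : Hom A B) → f · id ≈ f
    ·-cong : ∀ {A B C} {g g′ : Hom B C} {f f′ : Hom A B} →
             g ≈ g′ → f ≈ f′ → g · f ≈ g′ · f′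

module _ (𝐂 : Category o ℓ e) where
  open Category 𝐂

  infix 4 _⟶_

  -- hom(A,B) ≠ ∅, read as "hom(A,B) is inhabited".
  _⟶_ : Obj → Obj → Set ℓ
  A ⟶ B = Hom A B

  Directed : Set (o ⊔ ℓ)
  Directed = ∀ A B → ∃[ C ] (A ⟶ C) × (B ⟶ C)

  -- As a map of setoids, a colouring gives equal morphisms equal colours.
  Colouring : ℕ → Obj → Obj → Set (ℓ ⊔ e)
  Colouring k A C = hom A C ⟶ₛ setoid (Fin k)

  -- S = {χ(w · f) : f ∈ hom(A,B)}
  IsColourSet : ∀ {k A B C} → Colouring k A C → Hom B C → Subset k → Set ℓ
  IsColourSet {k} {A} {B} χ w S =
    ∀ (c : Fin k) → c ∈ S ⇔ (∃[ f ] Func.to χ (w · f) ≡ c)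

  -- Arrow k t A B C is C ⟶ (B)^A_{k,t}.
  Arrow : (k t : ℕ) (A B C : Obj) → Set (ℓ ⊔ e)
  Arrow k t A B C =
    (χ : Colouring k A C) →
    ∃[ w ] ∃[ S ] IsColourSet {k} {A} {B} {C} χ w S × ∣ S ∣ ≤ t

  RamseyBound : Obj → ℕ → Set (o ⊔ ℓ ⊔ e)
  RamseyBound A n =
    ∀ (k : ℕ) → NonZero k → ∀ (B : Obj) → A ⟶ B → ∃[ C ] Arrow k n A B C

  -- The graph of A ↦ t(A), with values in ℕ ∪ {∞}; ∞ is ⊤⁺.
  IsRamseyDegree : Obj → ℕ ⁺ → Set (o ⊔ ℓ ⊔ e)
  IsRamseyDegree A [ n ] =
    NonZero n × RamseyBound A n ×
    (∀ m → NonZero m → RamseyBound A m → n ≤ m)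
  IsRamseyDegree A ⊤⁺ = ∀ n → NonZero n → ¬ RamseyBound A n

  FiniteRamseyDegrees : Set (o ⊔ ℓ ⊔ e)
  FiniteRamseyDegrees = ∀ A → ∃[ n ] IsRamseyDegree A [ n ]

  WeakAmalgamation : Set (o ⊔ ℓ ⊔ e)
  WeakAmalgamation =
    ∀ A → ∃[ A′ ] ∃ λ (f : Hom A A′) →
    ∀ B C (g : Hom A′ B) (h : Hom A′ C) →
    ∃[ D ] ∃ λ (r : Hom B D) → ∃ λ (s : Hom C D) →
    r · g · f ≈ s · h · f

{-# OPTIONS --safe #-}
-- If weak amalgamation fails at A, every f : A → A′ is split by two morphisms
-- out of A′ into composites that can never be amalgamated. Joining the two
-- targets by directedness and iterating gives, for every m, an object B and
-- m + 1 morphisms f i : A → B such that w · f i = w′ · f j forces i = j.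
-- Colouring x : A → C by the i with x ∈ hom(B,C) · f i then makes every copy of
-- B in C see m + 1 colours, so no m bounds the Ramsey degree of A.
module Submission where

open import Defs
open import Level using (Level; _⊔_; Lift; lift; lower)
open import Axiom.ExcludedMiddle using (ExcludedMiddle)
open import Data.Empty using (⊥-elim)
open import Data.Fin using (Fin; zero; suc)
open import Data.Fin.Subset using (Subset; _∈_; ∣_∣; ⊤)
open import Data.Fin.Subset.Properties using (p⊆q⇒∣p∣≤∣q∣; ∣⊤∣≡n)
open import Data.Nat using (ℕ; zero; suc; _≤_; nonZero)
open import Data.Nat.Properties using (1+n≰n; ≤-trans)
open import Data.Product using (∃; ∃-syntax; _,_)
open import Function.Bundles using (Func; Equivalence)
open import Relation.Binary.Bundles using (Setoid)
open import Relation.Binary.PropositionalEquality using (_≡_; refl; cong; subst)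
open import Relation.Nullary using (¬_; Dec; yes; no)
open import Relation.Nullary.Decidable using (decidable-stable; map′)

full⇒n≤∣S∣ : ∀ {n} (S : Subset n) → (∀ c → c ∈ S) → n ≤ ∣ S ∣
full⇒n≤∣S∣ {n} S full = subst (_≤ ∣ S ∣) (∣⊤∣≡n n) (p⊆q⇒∣p∣≤∣q∣ {p = ⊤} {q = S} λ {c} _ → full c)

module _ {o ℓ e : Level} (em : ExcludedMiddle (o ⊔ ℓ ⊔ e)) (𝐂 : Category o ℓ e) where
  open Category 𝐂

  private
    module S {A B} = Setoid (hom A B)

  Amalgam : ∀ {A A′ B C} → Hom A A′ → Hom A′ B → Hom A′ C → Set (o ⊔ ℓ ⊔ e)
  Amalgam {B = B} {C} f g h =
    ∃[ D ] ∃ λ (r : Hom B D) → ∃ λ (s : Hom C D) → r · g · f ≈ s · h · f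

  Amalgamable : ∀ {A A′} → Hom A A′ → Set (o ⊔ ℓ ⊔ e)
  Amalgamable {A′ = A′} f = ∀ B C (g : Hom A′ B) (h : Hom A′ C) → Amalgam f g h

  Splitting : ∀ {A A′} → Hom A A′ → Set (o ⊔ ℓ ⊔ e)
  Splitting {A′ = A′} f =
    ∃[ B ] ∃[ C ] ∃ λ (g : Hom A′ B) → ∃ λ (h : Hom A′ C) → ¬ Amalgam f g h

  ¬amalgamable⇒splitting : ∀ {A A′} (f : Hom A A′) → ¬ Amalgamable f → Splitting f
  ¬amalgamable⇒splitting f ¬am = decidable-stable em λ ¬split →
    ¬am λ B C g h → decidable-stable em λ ¬a → ¬split (B , C , g , h , ¬a)

  -- Since `w` and `w′` vary independently, a composite `w · f i` determines `i` on its own,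
  -- whichever `w` produced it.
  Separated : ∀ {A B k} → (Fin k → Hom A B) → Set (o ⊔ ℓ ⊔ e)
  Separated {B = B} f =
    ∀ {E} i j (w w′ : Hom B E) → w · f i ≈ w′ · f j → i ≡ j

  SeparatedFamily : Obj → ℕ → Set (o ⊔ ℓ ⊔ e)
  SeparatedFamily A k = ∃[ B ] ∃ λ (f : Fin k → Hom A B) → Separated f

  private
    reassoc : ∀ {A B C D E} (w : Hom D E) (u : Hom C D) (g : Hom B C) (f : Hom A B) →
              w · (u · g) · f ≈ (w · u) · g · f
    reassoc w u g f = S.trans (·-cong S.refl (assoc u g f)) (S.sym (assoc w u (g · f)))

  -- The old family is carried along `u · g`, and one further morphism is `f zero` carried along
  -- `v · h`. Old separation still tells different old indices apart on either route, so the only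
  -- possible clash is between the two images of `f zero`.
  extendSeparated : ∀ {A k} → Directed 𝐂 → (∀ {A′} (f : Hom A A′) → Splitting f) →
                    SeparatedFamily A (suc k) → SeparatedFamily A (suc (suc k))
  extendSeparated {A} {k} directed split (B , f , sep)
    with split (f zero)
  ... | B₁ , B₂ , g , h , ¬amalgam
    with directed B₁ B₂
  ... | E , u , v = E , f′ , sep′
    where
    f′ : Fin (suc (suc k)) → Hom A E
    f′ zero    = (v · h) · f zero
    f′ (suc i) = (u · g) · f i

    f-index : ∀ {F} i j (p q : Hom B E) (w w′ : Hom E F) →
              w · p · f i ≈ w′ · q · f j → i ≡ j
    f-index i j p q w w′ eq = sep i j (w · p) (w′ · q)
      (S.trans (assoc w p (f i)) (S.trans eq (S.sym (assoc w′ q (f j)))))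

    g-h-differ : ∀ {F} i (w w′ : Hom E F) →
                 ¬ (w · (u · g) · f i ≈ w′ · (v · h) · f zero)
    g-h-differ i w w′ eq with f-index i zero (u · g) (v · h) w w′ eq
    -- Now `i` is `zero`, so the clash itself is an amalgam of `g` and `h` over `f zero`, with legs
    -- `w · u` and `w′ · v`.
    ... | refl = ¬amalgam (_ , w · u , w′ · v ,
      S.trans (S.sym (reassoc w u g (f zero))) (S.trans eq (reassoc w′ v h (f zero))))

    sep′ : Separated f′
    sep′ zero    zero    w w′ eq = refl
    sep′ zero    (suc j) w w′ eq = ⊥-elim (g-h-differ j w′ w (S.sym eq))
    sep′ (suc i) zero    w w′ eq = ⊥-elim (g-h-differ i w w′ eq)
    sep′ (suc i) (suc j) w w′ eq = cong suc (f-index i j (u · g) (u · g) w w′ eq)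

  separatedFamily : ∀ {A} → Directed 𝐂 → (∀ {A′} (f : Hom A A′) → Splitting f) →
                    ∀ k → SeparatedFamily A (suc k)
  -- Starting from one morphism ensures that there is always an `f zero` to split.
  separatedFamily {A} directed split zero    = A , (λ _ → id) , λ { zero zero _ _ _ → refl }
  separatedFamily     directed split (suc k) =
    extendSeparated directed split (separatedFamily directed split k)

  module _ {A B k} (f : Fin (suc k) → Hom A B) (sep : Separated f) (C : Obj) where

    FactorsThrough : Hom A C → Set (ℓ ⊔ e)
    FactorsThrough x = ∃[ i ] ∃ λ (w : Hom B C) → w · f i ≈ x

    index : ∀ {x} → Dec (FactorsThrough x) → Fin (suc k)
    index (yes (i , _)) = i
    -- An arbitrary default: only colours of composites `w · f i` matter later.
    index (no _)        = zero

    -- By separation the index does not depend on the factorization found. With `p` and `q`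
    -- arbitrary, this also lets a chosen factorization compute the colour.
    index-cong : ∀ {x y} → x ≈ y →
                 (p : Dec (FactorsThrough x)) (q : Dec (FactorsThrough y)) →
                 index p ≡ index q
    index-cong x≈y (yes (i , w , p)) (yes (j , w′ , q)) =
      sep i j w w′ (S.trans p (S.trans x≈y (S.sym q)))
    index-cong x≈y (yes (i , w , p)) (no ¬q) = ⊥-elim (¬q (i , w , S.trans p x≈y))
    index-cong x≈y (no ¬p) (yes (j , w , q)) = ⊥-elim (¬p (j , w , S.trans q (S.sym x≈y)))
    index-cong x≈y (no _)  (no _)            = refl

    factorsThrough? : ∀ x → Dec (FactorsThrough x)
    -- `Lift` raises the proposition to the universe of `em`.
    factorsThrough? x = map′ lower lift (em {P = Lift (o ⊔ ℓ ⊔ e) (FactorsThrough x)})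

    indexColouring : Colouring 𝐂 (suc k) A C
    indexColouring = record
      { to   = λ x → index (factorsThrough? x)
      ; cong = λ {x} {y} x≈y → index-cong x≈y (factorsThrough? x) (factorsThrough? y)
      }

    indexColouring-· : ∀ w i → Func.to indexColouring (w · f i) ≡ i
    indexColouring-· w i =
      index-cong S.refl (factorsThrough? (w · f i)) (yes (i , w , S.refl))

  separatedFamily⇒¬bound : ∀ {A n} → SeparatedFamily A (suc n) → ¬ RamseyBound 𝐂 A n
  separatedFamily⇒¬bound {A} {n} (B , f , sep) bound
    -- One colour more than the bound allows; every `w` will realize all of them.
    with bound (suc n) nonZero B (f zero)
  ... | C , arrow with arrow (indexColouring f sep C)
  ... | w , S , colours , ∣S∣≤n = 1+n≰n (≤-trans (full⇒n≤∣S∣ S full) ∣S∣≤n)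
    where
    full : ∀ c → c ∈ S
    full c = Equivalence.from (colours c) (f c , indexColouring-· f sep C w c)

theorem3p1 : ∀ {o ℓ e : Level} → ExcludedMiddle (o ⊔ ℓ ⊔ e) →
    (𝐂 : Category o ℓ e) → Directed 𝐂 → FiniteRamseyDegrees 𝐂 →
    WeakAmalgamation 𝐂
theorem3p1 em 𝐂 directed finite A with finite A
... | n , _ , bound , _ = decidable-stable em λ ¬wap →
  separatedFamily⇒¬bound em 𝐂
    (separatedFamily em 𝐂 directed
      (λ f → ¬amalgamable⇒splitting em 𝐂 f λ am → ¬wap (_ , f , am)) n)
    bound
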